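{- Let $G$ be a finite, simple, undirected graph. If $G$ is connected, then there exists a minimum positive semidefinite forcing set $S \subseteq V(G)$ of $G$ such that $G - S$ is connected.
   Context: All graphs are finite, simple and undirected. $G - S$ denotes the subgraph of $G$ induced by $V(G)\setminus S$. The graph with no vertices is regarded as connected (this matters only when $G - S$ is empty, e.g. when $G$ is a single vertex). Positive semidefinite forcing: the vertex set is partitioned as $V(G) = B \cup W$ into blue vertices $B$ and white vertices $W$. A blue vertex $u$ may force a white vertex $v$ to become blue if $v$ is the only neighbor of $u$ in the connected component of the induced subgraph $G[W]$ that contains $v$, where $W$ is the current set of white vertices. At each time step some set of valid forces (with respect to the current coloring) is performed, no white vertex being forced by more than one vertex, and the forced vertices are moved from $W$ to $B$. This is repeated until no further color changes are possible. If all vertices of $G$ are then blue, the initial set $B$ is called a positive semidefinite forcing set of $G$. A minimum positive semidefinite forcing set is one of minimum cardinality among all positive semidefinite forcing sets of $G$. -}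

module Defs where

open import Data.Fin.Base using (Fin)
open import Data.Fin.Subset using (Subset; _∈_; ∁; _∪_; ⋃; ⁅_⁆; ∣_∣; ⊤)
open import Data.List.Base using (List; map)
open import Data.List.Relation.Unary.All using (All)
open import Data.List.Relation.Unary.Unique.Propositional using (Unique)
open import Data.Nat.Base using (ℕ; _≤_)
open import Data.Product.Base using (∃; _×_; _,_; proj₁; proj₂; uncurry)
open import Function.Base using (_on_; _∘_)
open import Level using (0ℓ)
open import Relation.Binary.Construct.Closure.ReflexiveTransitive using (Star)
open import Relation.Binary.Core using (Rel)
open import Relation.Binary.Definitions using (Decidable; Irreflexive; Symmetric)
open import Relation.Binary.PropositionalEquality.Core using (_≡_; refl)
open import Relation.Nullary.Negation.Core using (¬_)

-- Finite graphs are the instances Graph (Fin n).  The vertex type is left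
-- general so that induced subgraphs are again graphs.
record Graph (V : Set) : Set₁ where
  field
    Adj        : Rel V 0ℓ
    Adj-sym    : Symmetric Adj
    Adj-irrefl : Irreflexive _≡_ Adj
    Adj?       : Decidable Adj

open Graph public

-- Joined by a walk, i.e. in the same connected component.
Linked : {V : Set} → Graph V → Rel V 0ℓ
Linked G = Star (Adj G)

-- Holds vacuously for the graph with no vertices.
Connected : {V : Set} → Graph V → Set
Connected G = ∀ u v → Linked G u v

module _ {n : ℕ} where

  induced : Graph (Fin n) → (U : Subset n) → Graph (∃ λ v → v ∈ U)
  induced G U = record
    { Adj        = Adj G on proj₁
    ; Adj-sym    = Adj-sym G
    ; Adj-irrefl = λ { refl → Adj-irrefl G refl }
    ; Adj?       = λ u v → Adj? G (proj₁ u) (proj₁ v)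
    }

  infixl 6 _∖_

  _∖_ : Graph (Fin n) → (S : Subset n) → Graph (∃ λ v → v ∈ ∁ S)
  G ∖ S = induced G (∁ S)

  -- A coloring is given by its set B of blue vertices; the white set is ∁ B.
  record Forces (G : Graph (Fin n)) (B : Subset n) (u v : Fin n) : Set where
    field
      blue     : u ∈ B
      white    : v ∈ ∁ B
      neighbor : Adj G u v
      only     : ∀ w (w∈W : w ∈ ∁ B) →
                 Linked (induced G (∁ B)) (v , white) (w , w∈W) →
                 Adj G u w → w ≡ v

  -- The pairs (u , v) in forces are the forces u → v performed
  -- simultaneously.  Since the targets are pairwise distinct, the list has no
  -- repetitions and no vertex is forced by two different vertices.
  record Step (G : Graph (Fin n)) (B B′ : Subset n) : Set where
    field
      forces  : List (Fin n × Fin n)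
      valid   : All (uncurry (Forces G B)) forces
      unique  : Unique (map proj₂ forces)
      updated : B′ ≡ B ∪ ⋃ (map (⁅_⁆ ∘ proj₂) forces)

  Final : Graph (Fin n) → Subset n → Set
  Final G B = ∀ u v → ¬ Forces G B u v

  PSDForcing : Graph (Fin n) → Subset n → Set
  PSDForcing G B = ∃ λ B′ → Star (Step G) B B′ × Final G B′ × B′ ≡ ⊤

  MinimumPSDForcing : Graph (Fin n) → Subset n → Set
  MinimumPSDForcing G S =
    PSDForcing G S × (∀ T → PSDForcing G T → ∣ S ∣ ≤ ∣ T ∣)

{-# OPTIONS --safe #-}
module Submission where

open import Defs
open import Data.Nat.Base using (ℕ; suc; _<_; _≤_; s≤s)
open import Data.Nat.Properties as ℕ using (_<?_)
open import Data.Nat.Induction using (<-wellFounded)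
open import Data.Fin.Base as Fin using (Fin)
open import Data.Fin.Properties using (_≟_; any?; all?)
open import Data.Fin.Subset
  using (Subset; inside; outside; _∈_; _∉_; _⊆_; _⊂_; _⊃_; ∁; _∪_; _─_; _-_; ⋃; ⁅_⁆; ⊤; ∣_∣; Nonempty)
open import Data.Fin.Subset.Induction using (Acc; acc; ⊂-wellFounded; ⊃-wellFounded)
open import Data.Fin.Subset.Properties
open import Data.List.Base using ([]; _∷_; map)
open import Data.List.Relation.Unary.All using (All; []; _∷_)
open import Data.List.Relation.Unary.AllPairs using ([]; _∷_)
open import Data.Product.Base using (∃; ∃₂; _×_; _,_; proj₁; proj₂; uncurry; map₂)
open import Data.Sum.Base using (_⊎_; inj₁; inj₂; [_,_]′)
open import Data.Vec.Base using (_∷_; here; there)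
open import Data.Vec.Properties.WithK using ([]=-irrelevant)
open import Function.Base using (_∘_; id)
open import Relation.Binary.Construct.Closure.ReflexiveTransitive
  using (Star; ε; _◅_; _◅◅_; gmap; reverse)
open import Relation.Binary.PropositionalEquality using (_≡_; _≢_; refl; sym; subst)
open import Relation.Nullary using (¬_; Dec; yes; no; contradiction; ¬?)
open import Relation.Nullary.Decidable using (_×-dec_; _⊎-dec_; _→-dec_; decidable-stable)
open import Relation.Unary using (Pred; Decidable)

-- S is a positive semidefinite forcing set iff every nonempty connected K
-- disjoint from S has a vertex u ∉ K with exactly one neighbor w in K.  If K is
-- moreover a component of G ∖ S, then u ∈ S and (S - u) ∪ ⁅ w ⁆ is forcing too.
-- Let S be a minimum forcing set and K a component of G ∖ S other than all of
-- G ∖ S.  As G is connected, some x ∈ S adjacent to K has a neighbor h outside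
-- K ∪ N(K).  If x has no neighbor in G ∖ S outside K, then h ∈ S and x forces h
-- from S - h, contradicting minimality.  Otherwise replacements u ↦ w are
-- made in a component containing neighbors of x, always keeping one of these
-- neighbors, until the replaced vertex u is adjacent to K.  Then K ∪ ⁅ u ⁆ is
-- connected and avoids the new minimum forcing set; iterate until K is all of
-- the complement.

-- Finite subsets: deletion, insertion and exchange of elements.

x∈p─q⇒x∉q : ∀ {n x} (p q : Subset n) → x ∈ p ─ q → x ∉ q
x∈p─q⇒x∉q (_ ∷ p) (_ ∷ q) (there i) (there j) = x∈p─q⇒x∉q p q i j
x∈p─q⇒x∉q (inside ∷ p) (inside ∷ q) () here
x∈p─q⇒x∉q (outside ∷ p) (inside ∷ q) () here

∣p∪⁅x⁆∣≤1+∣p∣ : ∀ {n} (p : Subset n) x → ∣ p ∪ ⁅ x ⁆ ∣ ≤ suc ∣ p ∣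
∣p∪⁅x⁆∣≤1+∣p∣ (inside  ∷ p) Fin.zero rewrite ∪-identityʳ p = ℕ.n≤1+n _
∣p∪⁅x⁆∣≤1+∣p∣ (outside ∷ p) Fin.zero rewrite ∪-identityʳ p = ℕ.≤-refl
∣p∪⁅x⁆∣≤1+∣p∣ (inside  ∷ p) (Fin.suc x) = s≤s (∣p∪⁅x⁆∣≤1+∣p∣ p x)
∣p∪⁅x⁆∣≤1+∣p∣ (outside ∷ p) (Fin.suc x) = ∣p∪⁅x⁆∣≤1+∣p∣ p x

module _ {n : ℕ} where

  x∉p-x : ∀ {x} (p : Subset n) → x ∉ p - x
  x∉p-x {x} p x∈ = x∈p─q⇒x∉q p ⁅ x ⁆ x∈ (x∈⁅x⁆ x)

  x∈p∪⁅x⁆ : ∀ {x} (p : Subset n) → x ∈ p ∪ ⁅ x ⁆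
  x∈p∪⁅x⁆ {x} p = q⊆p∪q p ⁅ x ⁆ (x∈⁅x⁆ x)

  x∈p∪⁅y⁆⁻ : ∀ {x y} (p : Subset n) → x ∈ p ∪ ⁅ y ⁆ → x ∈ p ⊎ x ≡ y
  x∈p∪⁅y⁆⁻ {y = y} p x∈ with x∈p∪q⁻ p ⁅ y ⁆ x∈
  ... | inj₁ x∈p = inj₁ x∈p
  ... | inj₂ x∈y = inj₂ (x∈⁅y⁆⇒x≡y y x∈y)

  p⊂p∪⁅x⁆ : ∀ {x} (p : Subset n) → x ∉ p → p ⊂ p ∪ ⁅ x ⁆
  p⊂p∪⁅x⁆ {x} p x∉p = p⊆p∪q ⁅ x ⁆ , x , x∈p∪⁅x⁆ p , x∉p

  p∪⁅x⁆⊆q : ∀ {x} {p q : Subset n} → p ⊆ q → x ∈ q → p ∪ ⁅ x ⁆ ⊆ q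
  p∪⁅x⁆⊆q {p = p} p⊆q x∈q y∈ with x∈p∪⁅y⁆⁻ p y∈
  ... | inj₁ y∈p  = p⊆q y∈p
  ... | inj₂ refl = x∈q

  allSubset? : ∀ {ℓ} {P : Pred (Subset n) ℓ} → Decidable P → Dec (∀ p → P p)
  allSubset? P? with anySubset? (¬? ∘ P?)
  ... | yes (p , ¬Pp) = no λ all → ¬Pp (all p)
  ... | no none       = yes λ p → decidable-stable (P? p) λ ¬Pp → none (p , ¬Pp)

  ∈∁[p-x]⁻ : ∀ {S : Subset n} {h z} → z ∈ ∁ (S - h) → z ≡ h ⊎ z ∈ ∁ S
  ∈∁[p-x]⁻ {S} {h} {z} z∈ with z ≟ h | z ∈? S
  ... | yes z≡h | _       = inj₁ z≡h
  ... | no _    | no z∉S  = inj₂ (x∉p⇒x∈∁p z∉S)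
  ... | no z≢h  | yes z∈S = contradiction (x∈p∧x≢y⇒x∈p-y z∈S z≢h) (x∈∁p⇒x∉p z∈)

  slide : Subset n → Fin n → Fin n → Subset n
  slide S u w = (S - u) ∪ ⁅ w ⁆

  module _ {S : Subset n} {u w : Fin n} where

    ∣slide∣≤ : u ∈ S → ∣ slide S u w ∣ ≤ ∣ S ∣
    ∣slide∣≤ u∈S = begin
      ∣ (S - u) ∪ ⁅ w ⁆ ∣      ≤⟨ ∣p∪⁅x⁆∣≤1+∣p∣ (S - u) w ⟩
      suc ∣ S - u ∣            ≤⟨ x∈p⇒∣p-x∣<∣p∣ u∈S ⟩
      ∣ S ∣                    ∎
      where
      open ℕ.≤-Reasoning

    ∈∁slide⁺ : ∀ {z} → z ∈ ∁ S → z ≢ w → z ∈ ∁ (slide S u w)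
    ∈∁slide⁺ z∈∁S z≢w = x∉p⇒x∈∁p λ z∈ →
      [ x∈∁p⇒x∉p z∈∁S ∘ p─q⊆p S ⁅ u ⁆ , z≢w ]′ (x∈p∪⁅y⁆⁻ (S - u) z∈)

    u∈∁slide : u ≢ w → u ∈ ∁ (slide S u w)
    u∈∁slide u≢w = x∉p⇒x∈∁p λ u∈ →
      [ x∉p-x S , u≢w ]′ (x∈p∪⁅y⁆⁻ (S - u) u∈)

    w∉∁slide : w ∉ ∁ (slide S u w)
    w∉∁slide = x∈p⇒x∉∁p (x∈p∪⁅x⁆ (S - u))

    ∈∁slide⁻ : ∀ {z} → z ∈ ∁ (slide S u w) → z ≡ u ⊎ z ∈ ∁ S
    ∈∁slide⁻ z∈ = ∈∁[p-x]⁻ {S} (p⊆q⇒∁p⊇∁q (p⊆p∪q ⁅ w ⁆) z∈)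

-- Walks, connected vertex sets and components.

module _ {V : Set} {H : Graph V} where

  linked-preserves : (P : V → Set) → (∀ {x y} → P x → Adj H x y → P y) →
                     ∀ {a b} → Linked H a b → P a → P b
  linked-preserves P step ε        Pa = Pa
  linked-preserves P step (r ◅ rs) Pa = linked-preserves P step rs (step Pa r)

  crossing-edge : {P : V → Set} → Decidable P → ∀ {a b} → Linked H a b → P a → ¬ P b →
                  ∃₂ λ x y → P x × ¬ P y × Adj H x y
  crossing-edge P? ε Pa ¬Pb = contradiction Pa ¬Pb
  crossing-edge P? (_◅_ {j = c} r rs) Pa ¬Pb with P? c
  ... | yes Pc = crossing-edge P? rs Pc ¬Pb
  ... | no ¬Pc = _ , c , Pa , ¬Pc , r

module _ {n : ℕ} (G : Graph (Fin n)) where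

  Conn : Subset n → Set
  Conn K = Connected (induced G K)

  -- For `K ⊆ W`: `K` is a union of components of the subgraph induced by `W`, and a single
  -- component if it is also nonempty and connected.
  Closed : Subset n → Subset n → Set
  Closed K W = ∀ {y z} → y ∈ K → z ∈ W → Adj G y z → z ∈ K

  linked-refl : ∀ {U : Subset n} {a} (p q : a ∈ U) → Linked (induced G U) (a , p) (a , q)
  linked-refl p q rewrite []=-irrelevant p q = ε

  linked-mono : ∀ {U U′ : Subset n} (i : U ⊆ U′) {a b : ∃ (_∈ U)} → Linked (induced G U) a b →
                ∀ {p q} → Linked (induced G U′) (proj₁ a , p) (proj₁ b , q)
  linked-mono i l = linked-refl _ _ ◅◅ gmap (map₂ i) id l ◅◅ linked-refl _ _

  linked-sym : ∀ {U : Subset n} {a b} → Linked (induced G U) a b → Linked (induced G U) b a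
  linked-sym = reverse (Adj-sym G)

  conn-preserves : ∀ {F : Subset n} → Conn F → (P : Fin n → Set) →
                   (∀ {y z} → y ∈ F → z ∈ F → P y → Adj G y z → P z) →
                   ∀ {a b} → a ∈ F → b ∈ F → P a → P b
  conn-preserves cF P step {a} {b} a∈F b∈F =
    linked-preserves {H = induced G _} (P ∘ proj₁) (λ {x} {y} → step (proj₂ x) (proj₂ y))
      (cF (a , a∈F) (b , b∈F))

  conn-⁅⁆ : ∀ v → Conn ⁅ v ⁆
  conn-⁅⁆ v (a , p) (b , q) with x∈⁅y⁆⇒x≡y v p | x∈⁅y⁆⇒x≡y v q
  ... | refl | refl = linked-refl p q

  conn-∪⁅⁆ : ∀ {K : Subset n} {x y} → Conn K → y ∈ K → Adj G y x → Conn (K ∪ ⁅ x ⁆)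
  conn-∪⁅⁆ {K} {x} {y} cK y∈K yx a b = to-y a ◅◅ linked-sym (to-y b)
    where
    to-y : ∀ a → Linked (induced G (K ∪ ⁅ x ⁆)) a (y , p⊆p∪q ⁅ x ⁆ y∈K)
    to-y (a , p) with x∈p∪⁅y⁆⁻ K p
    ... | inj₁ a∈K  = linked-mono (p⊆p∪q ⁅ x ⁆) (cK (a , a∈K) (y , y∈K))
    ... | inj₂ refl = Adj-sym G yx ◅ ε

  -- Adjoining a vertex of `W` adjacent to `K` keeps `K` connected; when no such vertex is left, `K`
  -- is closed.
  saturate : ∀ {W K : Subset n} → K ⊆ W → Conn K →
             ∃ λ C → K ⊆ C × C ⊆ W × Conn C × Closed C W
  saturate {W} {K} = go K (⊃-wellFounded K)
    where
    go : ∀ K → Acc _⊃_ K → K ⊆ W → Conn K → ∃ λ C → K ⊆ C × C ⊆ W × Conn C × Closed C W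
    go K (acc rec) K⊆W cK
      with any? (λ x → (x ∈? W) ×-dec ¬? (x ∈? K) ×-dec any? λ y → (y ∈? K) ×-dec Adj? G y x)
    ... | no none = K , id , K⊆W , cK , λ {y} {z} y∈K z∈W yz →
            decidable-stable (z ∈? K) λ z∉K → none (z , z∈W , z∉K , y , y∈K , yz)
    ... | yes (x , x∈W , x∉K , y , y∈K , yx)
      with go (K ∪ ⁅ x ⁆) (rec (p⊂p∪⁅x⁆ K x∉K)) (p∪⁅x⁆⊆q K⊆W x∈W) (conn-∪⁅⁆ cK y∈K yx)
    ... | C , K∪x⊆C , rest = C , K∪x⊆C ∘ p⊆p∪q ⁅ x ⁆ , rest

  component : ∀ {W : Subset n} {v} → v ∈ W →
              ∃ λ C → v ∈ C × C ⊆ W × Conn C × Closed C W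
  component {v = v} v∈W
    with saturate (λ x∈v → subst (_∈ _) (sym (x∈⁅y⁆⇒x≡y v x∈v)) v∈W) (conn-⁅⁆ v)
  ... | C , v⊆C , rest = C , v⊆C (x∈⁅x⁆ v) , rest

  -- A nonempty `K` is connected exactly when the component of one of its vertices fills it.
  conn? : Decidable Conn
  conn? K with nonempty? K
  ... | no ∅ = yes λ a → contradiction a ∅
  ... | yes (v , v∈K) with component v∈K
  ... | C , v∈C , C⊆K , cC , closed with K ⊆? C
  ... | yes K⊆C = yes λ (a , p) (b , q) → linked-mono C⊆K (cC (a , K⊆C p) (b , K⊆C q))
  ... | no K⊈C = no λ cK → K⊈C λ x∈K →
          conn-preserves cK (_∈ C) (λ _ z∈K y∈C → closed y∈C z∈K) v∈K x∈K v∈C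

  -- Hitting sets and their equivalence with forcing sets.

  UniqueNbr : Fin n → Subset n → Fin n → Set
  UniqueNbr u K w = w ∈ K × Adj G u w × (∀ z → z ∈ K → Adj G u z → z ≡ w)

  Enterable : Subset n → Set
  Enterable K = ∃₂ λ u w → u ∉ K × UniqueNbr u K w

  -- Decidable, which is what makes a minimum constructively available; the name
  -- says that S hits every nonempty connected set that cannot be entered.
  Hitting : Subset n → Set
  Hitting S = ∀ K → K ⊆ ∁ S → Nonempty K → Conn K → Enterable K

  enterable? : Decidable Enterable
  enterable? K = any? λ u → any? λ w →
    ¬? (u ∈? K) ×-dec (w ∈? K) ×-dec Adj? G u w ×-dec
    all? λ z → (z ∈? K) →-dec Adj? G u z →-dec (z ≟ w)

  hitting? : Decidable Hitting
  hitting? S = allSubset? λ K →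
    (K ⊆? ∁ S) →-dec nonempty? K →-dec conn? K →-dec enterable? K

  hitting-⊤ : Hitting ⊤
  hitting-⊤ K K⊆∁⊤ (x , x∈K) = contradiction ∈⊤ (x∈∁p⇒x∉p (K⊆∁⊤ x∈K))

  ∈⋃-targets : ∀ {B : Subset n} {z} fs → All (uncurry (Forces G B)) fs →
               z ∈ ⋃ (map (⁅_⁆ ∘ proj₂) fs) → ∃ λ u → Forces G B u z
  ∈⋃-targets [] [] z∈⊥ = contradiction z∈⊥ ∉⊥
  ∈⋃-targets ((u , v) ∷ fs) (f ∷ valid) z∈ with x∈p∪q⁻ ⁅ v ⁆ _ z∈
  ... | inj₁ z∈v rewrite x∈⁅y⁆⇒x≡y v z∈v = u , f
  ... | inj₂ z∈⋃ = ∈⋃-targets fs valid z∈⋃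

  -- The condition `only` ranges over the white component of `w`, which contains the connected white
  -- set `K`.
  forces⇒enterable : ∀ {B K : Subset n} {u w} → K ⊆ ∁ B → Conn K → w ∈ K → Forces G B u w → Enterable K
  forces⇒enterable {u = u} {w} K⊆∁B cK w∈K f = u , w ,
    (λ u∈K → x∈p⇒x∉∁p blue (K⊆∁B u∈K)) , w∈K , neighbor ,
    λ z z∈K → only z (K⊆∁B z∈K) (linked-mono K⊆∁B (cK (w , w∈K) (z , z∈K)))
    where open Forces f

  -- Some step is the first to color a vertex of `K`. Just before it `K` is entirely white, so the
  -- force performed on that vertex enters `K`.
  reaches-⊤⇒hitting : ∀ {S T} → Star (Step G) S T → T ≡ ⊤ → Hitting S
  reaches-⊤⇒hitting ε refl = hitting-⊤
  reaches-⊤⇒hitting (_◅_ {j = B} step steps) T≡⊤ K K⊆∁S ne cK with K ⊆? ∁ B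
  ... | yes K⊆∁B = reaches-⊤⇒hitting steps T≡⊤ K K⊆∁B ne cK
  ... | no K⊈∁B with any? (λ z → (z ∈? K) ×-dec (z ∈? B))
  ...   | no none = contradiction (λ {z} z∈K → x∉p⇒x∈∁p λ z∈B → none (z , z∈K , z∈B)) K⊈∁B
  ...   | yes (z , z∈K , z∈B) with x∈p∪q⁻ _ _ (subst (z ∈_) (Step.updated step) z∈B)
  ...     | inj₁ z∈S = contradiction (K⊆∁S z∈K) (x∈p⇒x∉∁p z∈S)
  ...     | inj₂ z∈⋃ = forces⇒enterable K⊆∁S cK z∈K
              (proj₂ (∈⋃-targets (Step.forces step) (Step.valid step) z∈⋃))

  -- While white vertices remain, a white component `C` can be entered; the entering `u` is outside
  -- `C` but adjacent to it, hence blue, and the force is valid. One force per step is enough: the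
  -- larger blue set is still hitting, as every set avoiding it also avoids `B`.
  hitting⇒reaches-⊤ : ∀ S → Hitting S → Star (Step G) S ⊤
  hitting⇒reaches-⊤ S = go S (⊃-wellFounded S)
    where
    go : ∀ B → Acc _⊃_ B → Hitting B → Star (Step G) B ⊤
    go B (acc rec) hit with nonempty? (∁ B)
    ... | no ∅ rewrite ⊆-antisym {i = B} ⊆⊤ (λ {x} _ → x∉∁p⇒x∈p λ x∈ → ∅ (x , x∈)) = ε
    ... | yes (v , v∈∁B) with component v∈∁B
    ... | C , v∈C , C⊆∁B , cC , closed with hit C C⊆∁B (v , v∈C) cC
    ... | u , w , u∉C , w∈C , uw , unique =
      step ◅ go (B ∪ ⋃ (⁅ w ⁆ ∷ [])) (rec (subst (λ p → B ⊂ B ∪ p) (sym (∪-identityʳ ⁅ w ⁆))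
        (p⊂p∪⁅x⁆ B (x∈∁p⇒x∉p w∈∁B))))
        λ K K⊆ → hit K (λ x∈K → p⊆q⇒∁p⊇∁q (p⊆p∪q _) (K⊆ x∈K))
      where
      w∈∁B = C⊆∁B w∈C
      force : Forces G B u w
      force = record
        { blue     = decidable-stable (u ∈? B) λ u∉B →
                       u∉C (closed w∈C (x∉p⇒x∈∁p u∉B) (Adj-sym G uw))
        ; white    = w∈∁B
        ; neighbor = uw
        ; only     = λ z z∈∁B l → unique z
            (linked-preserves {H = induced G (∁ B)} ((_∈ C) ∘ proj₁)
              (λ {_} {b} a∈C → closed a∈C (proj₂ b)) l w∈C)
        }
      step : Step G B (B ∪ ⋃ (⁅ w ⁆ ∷ []))
      step = record
        { forces  = (u , w) ∷ []
        ; valid   = force ∷ []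
        ; unique  = [] ∷ []
        ; updated = refl
        }

  psd⇒hitting : ∀ {S} → PSDForcing G S → Hitting S
  psd⇒hitting (_ , steps , _ , T≡⊤) = reaches-⊤⇒hitting steps T≡⊤

  hitting⇒psd : ∀ {S} → Hitting S → PSDForcing G S
  hitting⇒psd {S} hit = ⊤ , hitting⇒reaches-⊤ S hit , final , refl
    where
    final : Final G ⊤
    final u v f = x∈p⇒x∉∁p ∈⊤ (Forces.white f)

  -- Minimum hitting sets and sliding.

  MinimumHitting : Subset n → Set
  MinimumHitting S = Hitting S × (∀ T → Hitting T → ∣ S ∣ ≤ ∣ T ∣)

  ∃-minimumHitting : ∃ MinimumHitting
  ∃-minimumHitting = go ⊤ (<-wellFounded _) hitting-⊤
    where
    go : ∀ S → Acc _<_ ∣ S ∣ → Hitting S → ∃ MinimumHitting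
    go S (acc rec) hit with anySubset? (λ T → hitting? T ×-dec (∣ T ∣ <? ∣ S ∣))
    ... | yes (T , hitT , T<S) = go T (rec T<S) hitT
    ... | no none = S , hit , λ T hitT → ℕ.≮⇒≥ λ T<S → none (T , hitT , T<S)

  -- The force is reversed. A connected `F` that avoids the new set but not `S` contains `u`. The
  -- only edge from `u` into `U` ends in `w`, which `F` avoids, and no other vertex of `F` has a
  -- neighbor in `U` without being in `U`; so `F` never meets `U`. Any neighbor of `w` in `F` other
  -- than `u` would lie in `U`, hence `w` enters `F` at `u`.
  slide-hitting : ∀ {S U : Subset n} {u w} → Hitting S → Closed U (∁ S) → u ∉ U →
                  UniqueNbr u U w → Hitting (slide S u w)
  slide-hitting {S} {U} {u} {w} hit closed u∉U (w∈U , uw , unique) F F⊆ ne cF with u ∈? F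
  ... | no u∉F = hit F F⊆∁S ne cF
    where
    F⊆∁S : F ⊆ ∁ S
    F⊆∁S z∈F with ∈∁slide⁻ (F⊆ z∈F)
    ... | inj₁ refl = contradiction z∈F u∉F
    ... | inj₂ z∈∁S = z∈∁S
  ... | yes u∈F = w , u , w∉F , u∈F , Adj-sym G uw , only-u
    where
    w∉F : w ∉ F
    w∉F = w∉∁slide {S = S} ∘ F⊆
    F-avoids-U : ∀ {z} → z ∈ F → z ∉ U
    F-avoids-U z∈F = conn-preserves cF (_∉ U) avoid u∈F z∈F u∉U
      where
      avoid : ∀ {y z} → y ∈ F → z ∈ F → y ∉ U → Adj G y z → z ∉ U
      avoid y∈F z∈F y∉U yz z∈U with ∈∁slide⁻ (F⊆ y∈F)
      ... | inj₁ refl = w∉F (subst (_∈ F) (unique _ z∈U yz) z∈F)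
      ... | inj₂ y∈∁S = y∉U (closed z∈U y∈∁S (Adj-sym G yz))
    only-u : ∀ z → z ∈ F → Adj G w z → z ≡ u
    only-u z z∈F wz with ∈∁slide⁻ (F⊆ z∈F)
    ... | inj₁ z≡u  = z≡u
    ... | inj₂ z∈∁S = contradiction (closed w∈U z∈∁S wz) (F-avoids-U z∈F)

  slide-minimum : ∀ {S U : Subset n} {u w} → MinimumHitting S → Closed U (∁ S) → u ∈ S → u ∉ U →
                  UniqueNbr u U w → MinimumHitting (slide S u w)
  slide-minimum (hit , least) closed u∈S u∉U nbr =
    slide-hitting hit closed u∉U nbr ,
    λ T hitT → ℕ.≤-trans (∣slide∣≤ u∈S) (least T hitT)

  -- Enlarging a component `K` by a vertex of `N(K)`.

  Near : Subset n → Fin n → Set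
  Near K x = x ∉ K × ∃ λ k → k ∈ K × Adj G k x

  near? : ∀ K → Decidable (Near K)
  near? K x = ¬? (x ∈? K) ×-dec any? λ k → (k ∈? K) ×-dec Adj? G k x

  Growth : Subset n → Set
  Growth K = ∃₂ λ S x → MinimumHitting S × K ∪ ⁅ x ⁆ ⊆ ∁ S × Near K x

  near⇒∈ : ∀ {S K : Subset n} {x} → Closed K (∁ S) → Near K x → x ∈ S
  near⇒∈ closed (x∉K , k , k∈K , kx) = x∉∁p⇒x∈p λ x∈∁S → x∉K (closed k∈K x∈∁S kx)

  -- U only shrinks and keeps a neighbor c of x; at the latest when c is the only
  -- neighbor of x in its component of U, x itself can be slid to c.
  chase : ∀ {K x} → Near K x → ∀ U → Acc _⊂_ U → ∀ S → MinimumHitting S →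
          K ⊆ ∁ S → Closed K (∁ S) →
          U ⊆ ∁ S → Closed U (∁ S) → (∀ {z} → z ∈ U → z ∉ K) →
          ∀ c → c ∈ U → Adj G x c → Growth K
  chase {K} {x} xK U (acc rec) S min K⊆ closedK U⊆ closedU U∌K c c∈U xc
    with component c∈U
  ... | C , c∈C , C⊆U , cC , closedC = pick
    where
    closedC′ : Closed C (∁ S)
    closedC′ y∈C z∈ yz = closedC y∈C (closedU (C⊆U y∈C) z∈ yz) yz
    C⊆ : C ⊆ ∁ S
    C⊆ = U⊆ ∘ C⊆U

    -- As `u` is near the closed set `K`, it belongs to `S`. The slide releases it, and `w`, lying
    -- in `U`, is not taken from `K`.
    grow : ∀ {u w} → Near K u → UniqueNbr u C w → Growth K
    grow {u} {w} uK nbr@(w∈C , _) =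
      slide S u w , u , slide-minimum min closedC′ u∈S (λ u∈C → x∈p⇒x∉∁p u∈S (C⊆ u∈C)) nbr ,
      p∪⁅x⁆⊆q (λ {z} z∈K → ∈∁slide⁺ (K⊆ z∈K) λ { refl → U∌K (C⊆U w∈C) z∈K })
        (u∈∁slide {S = S} λ { refl → x∈p⇒x∉∁p u∈S (C⊆ w∈C) }) ,
      uK
      where
      u∈S = near⇒∈ {S = S} closedK uK

    -- Releasing `u` leaves `K` closed because `u` is not near `K`, and leaves `C - w` closed
    -- because `w` was the only neighbor of `u` in `C`.
    advance : ∀ {u w} → u ∉ C → UniqueNbr u C w → ¬ Near K u →
              ∀ d → d ∈ C → Adj G x d → d ≢ w → Growth K
    advance {u} {w} u∉C nbr@(w∈C , uw , unique) ¬uK d d∈C xd d≢w =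
      chase xK (C - w) (rec (⊂-⊆-trans (x∈p⇒p-x⊂p w∈C) C⊆U)) (slide S u w)
        (slide-minimum min closedC′ u∈S u∉C nbr)
        (λ z∈K → ∈∁slide⁺ (K⊆ z∈K) λ { refl → U∌K (C⊆U w∈C) z∈K })
        closedK′
        (λ z∈ → ∈∁slide⁺ (C⊆ (p─q⊆p C ⁅ w ⁆ z∈)) λ { refl → x∉p-x C z∈ })
        closed-w
        (λ z∈ → U∌K (C⊆U (p─q⊆p C ⁅ w ⁆ z∈)))
        d (x∈p∧x≢y⇒x∈p-y d∈C d≢w) xd
      where
      u∈S : u ∈ S
      u∈S = x∉∁p⇒x∈p λ u∈∁S → u∉C (closedC′ w∈C u∈∁S (Adj-sym G uw))
      closedK′ : Closed K (∁ (slide S u w))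
      closedK′ {y} {z} y∈K z∈ yz with ∈∁slide⁻ z∈
      ... | inj₁ refl = decidable-stable (z ∈? K) λ u∉K → ¬uK (u∉K , y , y∈K , yz)
      ... | inj₂ z∈∁S = closedK y∈K z∈∁S yz
      closed-w : Closed (C - w) (∁ (slide S u w))
      closed-w {y} {z} y∈ z∈ yz with ∈∁slide⁻ z∈
      ... | inj₁ refl with unique y (p─q⊆p C ⁅ w ⁆ y∈) (Adj-sym G yz)
      ...   | refl = contradiction y∈ (x∉p-x C)
      closed-w {y} {z} y∈ z∈ yz | inj₂ z∈∁S =
        x∈p∧x≢y⇒x∈p-y (closedC′ (p─q⊆p C ⁅ w ⁆ y∈) z∈∁S yz) λ { refl → w∉∁slide {S = S} z∈ }

    pick : Growth K
    pick with any? (λ d → (d ∈? C) ×-dec Adj? G x d ×-dec ¬? (d ≟ c))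
    ... | no none = grow xK (c∈C , xc , λ z z∈C xz →
            decidable-stable (z ≟ c) λ z≢c → none (z , z∈C , xz , z≢c))
    ... | yes (d , d∈C , xd , d≢c) with proj₁ min C C⊆ (c , c∈C) cC
    ... | u , w , u∉C , nbr with near? K u
    ... | yes uK = grow uK nbr
    -- The slide removes `w` from `C`; of the two neighbors `c` and `d` of `x`, at least one
    -- survives.
    ... | no ¬uK with c ≟ w
    ... | no c≢w   = advance u∉C nbr ¬uK c c∈C xc c≢w
    ... | yes refl = advance u∉C nbr ¬uK d d∈C xd d≢c

  -- Only connected sets `F` containing `h` are new. Vertices near `K` are in `S` and differ from
  -- `h`, so `F` contains none of them and, starting at `h` outside `K`, cannot reach `K`. The
  -- neighbors of `x` in `∁ S` all lie in `K`, which leaves `h` as the only neighbor of `x` in `F`.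
  redundant : ∀ {S K : Subset n} {x h} → Hitting S → Closed K (∁ S) → Near K x →
              h ∉ K → ¬ Near K h → Adj G x h →
              (∀ z → z ∈ ∁ S → Adj G x z → z ∈ K) → Hitting (S - h)
  redundant {S} {K} {x} {h} hit closed xK h∉K ¬hK xh only-K F F⊆ ne cF with h ∈? F
  ... | no h∉F = hit F F⊆∁S ne cF
    where
    F⊆∁S : F ⊆ ∁ S
    F⊆∁S z∈F with ∈∁[p-x]⁻ {S = S} (F⊆ z∈F)
    ... | inj₁ refl = contradiction z∈F h∉F
    ... | inj₂ z∈∁S = z∈∁S
  ... | yes h∈F = x , h , x∉F , h∈F , xh , only-h
    where
    F-avoids-Near : ∀ {z} → z ∈ F → ¬ Near K z
    F-avoids-Near z∈F zK with ∈∁[p-x]⁻ {S = S} (F⊆ z∈F)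
    ... | inj₁ refl = ¬hK zK
    ... | inj₂ z∈∁S = x∈p⇒x∉∁p (near⇒∈ {S = S} closed zK) z∈∁S
    x∉F : x ∉ F
    x∉F x∈F = F-avoids-Near x∈F xK
    F-avoids-K : ∀ {z} → z ∈ F → z ∉ K
    F-avoids-K z∈F = conn-preserves cF (_∉ K)
      (λ y∈F _ y∉K yz z∈K → F-avoids-Near y∈F (y∉K , _ , z∈K , Adj-sym G yz)) h∈F z∈F h∉K
    only-h : ∀ z → z ∈ F → Adj G x z → z ≡ h
    only-h z z∈F xz with ∈∁[p-x]⁻ {S = S} (F⊆ z∈F)
    ... | inj₁ z≡h  = z≡h
    ... | inj₂ z∈∁S = contradiction (only-K z z∈∁S xz) (F-avoids-K z∈F)

  growth : Connected G → ∀ {S K : Subset n} → MinimumHitting S → Nonempty K → K ⊆ ∁ S →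
           Closed K (∁ S) → ¬ (∁ S ⊆ K) → Growth K
  growth conn {S} {K} min@(hit , least) (k , k∈K) K⊆ closed ∁S⊈K
    with any? (λ y → (y ∈? ∁ S) ×-dec ¬? (y ∈? K))
  ... | no none = contradiction
          (λ {y} y∈ → decidable-stable (y ∈? K) λ y∉K → none (y , y∈ , y∉K)) ∁S⊈K
  ... | yes (y , y∈∁S , y∉K)
    -- The walk from `k` to `y` must leave `K ∪ N(K)`: `y` is outside `K` and, not being in `S`, is
    -- not near `K`.
    with crossing-edge {H = G} (λ z → (z ∈? K) ⊎-dec near? K z) (conn k y) (inj₁ k∈K)
           [ y∉K , (λ yK → x∈p⇒x∉∁p (near⇒∈ {S = S} closed yK) y∈∁S) ]′
  -- An edge starting in `K` ends in `K` or in `N(K)`, so the edge leaving both starts in `N(K)`.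
  ... | x , h , inj₁ x∈K , h-far , xh =
    contradiction (inj₂ (h-far ∘ inj₁ , x , x∈K , xh)) h-far
  ... | x , h , inj₂ xK , h-far , xh
    with any? (λ c → (c ∈? ∁ S) ×-dec Adj? G x c ×-dec ¬? (c ∈? K))
  ... | no none = contradiction (least (S - h) S-h-hits) (ℕ.<⇒≱ (x∈p⇒∣p-x∣<∣p∣ h∈S))
    where
    only-K : ∀ z → z ∈ ∁ S → Adj G x z → z ∈ K
    only-K z z∈ xz = decidable-stable (z ∈? K) λ z∉K → none (z , z∈ , xz , z∉K)
    h∈S : h ∈ S
    h∈S = x∉∁p⇒x∈p λ h∈∁S → h-far (inj₁ (only-K h h∈∁S xh))
    S-h-hits : Hitting (S - h)
    S-h-hits = redundant hit closed xK (h-far ∘ inj₁) (h-far ∘ inj₂) xh only-K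
  ... | yes (c , c∈∁S , xc , c∉K) =
    -- The chase starts in the union of all components of `G ∖ S` other than `K`.
    chase xK (∁ S ─ K) (⊂-wellFounded _) S min K⊆ closed
      (p─q⊆p (∁ S) K)
      (λ y∈ z∈∁S yz → x∈p∧x∉q⇒x∈p─q z∈∁S λ z∈K →
        x∈p─q⇒x∉q (∁ S) K y∈ (closed z∈K (p─q⊆p (∁ S) K y∈) (Adj-sym G yz)))
      (x∈p─q⇒x∉q (∁ S) K)
      c (x∈p∧x∉q⇒x∈p─q c∈∁S c∉K) xc

  ∃-minimumHitting-conn : Connected G → ∃ λ S → MinimumHitting S × Connected (G ∖ S)
  ∃-minimumHitting-conn conn with ∃-minimumHitting
  ... | S , min with nonempty? (∁ S)
  ... | no ∅ = S , min , λ a → contradiction a ∅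
  ... | yes (v , v∈∁S) with component v∈∁S
  ... | C , v∈C , C⊆ , cC , _ = go C (⊃-wellFounded C) S min (v , v∈C) C⊆ cC
    where
    go : ∀ K → Acc _⊃_ K → ∀ S → MinimumHitting S → Nonempty K → K ⊆ ∁ S → Conn K →
         ∃ λ S → MinimumHitting S × Connected (G ∖ S)
    -- The recursion is on `K`, since `S` changes from round to round. For the new `S`, `K` is
    -- connected and avoided but perhaps not a whole component, so it is saturated first.
    go K (acc rec) S min (k , k∈K) K⊆ cK with saturate K⊆ cK
    ... | C , K⊆C , C⊆ , cC , closed with ∁ S ⊆? C
    ... | yes ∁S⊆C = S , min , λ (a , p) (b , q) →
            linked-mono C⊆ (cC (a , ∁S⊆C p) (b , ∁S⊆C q))
    ... | no ∁S⊈C with growth conn min (k , K⊆C k∈K) C⊆ closed ∁S⊈C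
    ... | S′ , x , min′ , C∪x⊆ , x∉C , y , y∈C , yx =
      go (C ∪ ⁅ x ⁆) (rec (⊆-⊂-trans K⊆C (p⊂p∪⁅x⁆ C x∉C))) S′ min′
        (k , p⊆p∪q ⁅ x ⁆ (K⊆C k∈K)) C∪x⊆ (conn-∪⁅⁆ cC y∈C yx)

lemma4 : (n : ℕ) (G : Graph (Fin n)) → Connected G →
    ∃ λ (S : Subset n) → MinimumPSDForcing G S × Connected (G ∖ S)
lemma4 n G conn with ∃-minimumHitting-conn G conn
... | S , (hit , least) , connected =
  S , (hitting⇒psd G hit , λ T psd → least T (psd⇒hitting G psd)) , connected
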